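{- For every positive integer $n$, the order supergraph $\mathcal{S}(S_n)$ of the symmetric group $S_n$ is cyclically separable if and only if $n \geq 4$.
   Context: All graphs are simple and undirected. For a finite group $G$, the order supergraph $\mathcal{S}(G)$ is the graph with vertex set $G$ in which two distinct vertices $x,y$ are adjacent if and only if the order of $x$ divides the order of $y$ or the order of $y$ divides the order of $x$. For a graph $\Gamma$, a vertex cutset is a set $S$ of vertices such that $\Gamma - S$ is disconnected; a cyclic vertex cutset is a vertex cutset $S$ such that $\Gamma - S$ has at least two connected components each of which contains a cycle. $\Gamma$ is called cyclically separable if it has a cyclic vertex cutset. -}

module Defs where

open import Level using (0ℓ) renaming (suc to lsuc)
open import Algebra.Bundles using (Group)
import Algebra.Definitions.RawMonoid as RawMonoidDefs
open import Data.Fin.Base using (Fin; zero; suc; inject₁; fromℕ)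
import Data.Fin.Permutation as Perm
open import Data.Nat.Base using (ℕ; _+_; _≤_; _<_)
open import Data.Nat.Divisibility using (_∣_)
open import Data.Product.Base using (∃; ∃-syntax; Σ-syntax; _×_; _,_; proj₁; proj₂)
open import Data.Sum.Base using (_⊎_)
import Data.Sum.Base as Sum
open import Function.Base using (_∘_; _on_)
open import Relation.Binary.Bundles using (Setoid)
open import Relation.Binary.Core using (Rel)
import Relation.Binary.Construct.On as On
open import Relation.Binary.Construct.Closure.ReflexiveTransitive using (Star)
open import Relation.Binary.Construct.Union using (_∪_)
open import Relation.Binary.Definitions
  using (Irreflexive; Symmetric; _Respects_; _Respects₂_)
open import Relation.Binary.PropositionalEquality
  using (_≡_; refl; sym; trans; cong)
open import Relation.Nullary.Negation using (¬_)
open import Relation.Unary using (Pred; _∈_; _∉_; _≐_)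

-- A simple undirected graph. The vertices form a setoid because
-- permutations are compared pointwise: vertices are distinct when they
-- are not _≈_.
record Graph : Set₁ where
  infix 4 _~_
  field
    vertices : Setoid 0ℓ 0ℓ
  open Setoid vertices public
    using (_≈_)
    renaming (Carrier to V)
  field
    _~_      : Rel V 0ℓ
    ~-irrefl : Irreflexive _≈_ _~_
    ~-sym    : Symmetric _~_
    ~-resp-≈ : _~_ Respects₂ _≈_

module _ (Γ : Graph) where
  open Graph Γ

  -- Existence of a walk; steps along _≈_ stay at the same vertex.
  Reachable : Rel V 0ℓ
  Reachable = Star (_≈_ ∪ _~_)

  Connected : Set
  Connected = ∀ u v → Reachable u v

  Disconnected : Set
  Disconnected = ¬ Connected

  component : V → Pred V 0ℓ
  component = Reachable

  -- A cycle c₀ c₁ … cₘ₊₂ of length m + 3, closed up by an edge from cₘ₊₂ to c₀.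
  record Cycle : Set where
    field
      {m}       : ℕ
      c         : Fin (3 + m) → V
      injective : ∀ {i j} → c i ≈ c j → i ≡ j
      adjacent  : ∀ (i : Fin (2 + m)) → c (inject₁ i) ~ c (suc i)
      closed    : c (fromℕ (2 + m)) ~ c zero

  ContainsCycle : Pred V 0ℓ → Set
  ContainsCycle C = Σ[ γ ∈ Cycle ] (∀ i → Cycle.c γ i ∈ C)

infixl 6 _-_

_-_ : (Γ : Graph) → Pred (Graph.V Γ) 0ℓ → Graph
Γ - S = record
  { vertices = On.setoid {B = ∃ (_∉ S)} vertices proj₁
  ; _~_      = _~_ on proj₁
  ; ~-irrefl = ~-irrefl
  ; ~-sym    = ~-sym
  ; ~-resp-≈ = (λ {_} → proj₁ ~-resp-≈) , (λ {_} → proj₂ ~-resp-≈)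
  }
  where open Graph Γ

module _ (Γ : Graph) where
  open Graph Γ

  record IsVertexCutset (S : Pred V 0ℓ) : Set where
    field
      resp-≈       : S Respects _≈_
      disconnected : Disconnected (Γ - S)

  record IsCyclicVertexCutset (S : Pred V 0ℓ) : Set where
    field
      isVertexCutset      : IsVertexCutset S
      twoCyclicComponents :
        ∃[ u ] ∃[ v ]
          ¬ (component (Γ - S) u ≐ component (Γ - S) v)
          × ContainsCycle (Γ - S) (component (Γ - S) u)
          × ContainsCycle (Γ - S) (component (Γ - S) v)

  CyclicallySeparable : Set₁
  CyclicallySeparable = ∃[ S ] IsCyclicVertexCutset S

module _ (G : Group 0ℓ 0ℓ) where
  open Group G renaming (refl to ≈-refl; sym to ≈-sym; trans to ≈-trans)
  open RawMonoidDefs rawMonoid using () renaming (_×_ to power)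

  -- power k x is the k-th power of x (the library writes it additively).
  record HasOrder (x : Carrier) (k : ℕ) : Set where
    field
      positive : 0 < k
      power≈ε  : power k x ≈ ε
      minimal  : ∀ m → 0 < m → power m x ≈ ε → k ≤ m

  OrderAdjacent : Rel Carrier 0ℓ
  OrderAdjacent x y =
    ¬ (x ≈ y) × ∃[ k ] ∃[ l ] HasOrder x k × HasOrder y l × (k ∣ l ⊎ l ∣ k)

  private
    power-cong : ∀ k {x y} → x ≈ y → power k x ≈ power k y
    power-cong ℕ.zero    x≈y = ≈-refl
    power-cong (ℕ.suc k) x≈y = ∙-cong x≈y (power-cong k x≈y)

    hasOrder-resp : ∀ {k x y} → x ≈ y → HasOrder x k → HasOrder y k
    hasOrder-resp {k} x≈y o = record
      { positive = positive
      ; power≈ε  = ≈-trans (power-cong k (≈-sym x≈y)) power≈ε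
      ; minimal  = λ m 0<m e → minimal m 0<m (≈-trans (power-cong m x≈y) e)
      }
      where open HasOrder o

  -- The relation HasOrder stands in for the order function, which is total
  -- when G is finite.
  orderSupergraph : Graph
  orderSupergraph = record
    { vertices = setoid
    ; _~_      = OrderAdjacent
    ; ~-irrefl = λ x≈y (x≉y , _) → x≉y x≈y
    ; ~-sym    = λ (x≉y , k , l , ox , oy , d) →
                   x≉y ∘ ≈-sym , l , k , oy , ox , Sum.swap d
    ; ~-resp-≈ = (λ y≈z (x≉y , k , l , ox , oy , d) →
                   (λ x≈z → x≉y (≈-trans x≈z (≈-sym y≈z)))
                   , k , l , ox , hasOrder-resp y≈z oy , d)
               , (λ x≈z (x≉y , k , l , ox , oy , d) →
                   (λ z≈y → x≉y (≈-trans x≈z z≈y))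
                   , k , l , hasOrder-resp x≈z ox , oy , d)
    }

-- Composition is Perm._∘ₚ_, which applies its left factor first.
symmetricGroup : ℕ → Group 0ℓ 0ℓ
symmetricGroup n = record
  { Carrier = Perm.Permutation′ n
  ; _≈_     = Perm._≈_
  ; _∙_     = Perm._∘ₚ_
  ; ε       = Perm.id
  ; _⁻¹     = Perm.flip
  ; isGroup = record
    { isMonoid = record
      { isSemigroup = record
        { isMagma = record
          { isEquivalence = record
            { refl  = λ _ → refl
            ; sym   = λ p i → sym (p i)
            ; trans = λ p q i → trans (p i) (q i)
            }
          ; ∙-cong = λ {_} {_} {u} p q i →
              trans (cong (u Perm.⟨$⟩ʳ_) (p i)) (q _)
          }
        ; assoc = λ _ _ _ _ → refl
        }
      ; identity = (λ _ _ → refl) , (λ _ _ → refl)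
      }
    ; inverse = (λ π _ → Perm.inverseʳ π) , (λ π _ → Perm.inverseˡ π)
    ; ⁻¹-cong = λ {π} {ρ} p i →
        trans (cong (π Perm.⟨$⟩ˡ_) (trans (sym (Perm.inverseʳ ρ)) (sym (p _))))
              (Perm.inverseˡ π)
    }
  }

{-# OPTIONS --safe #-}

-- For n ≥ 4, deleting all elements whose order is neither 2 nor 3 leaves the
-- cliques of involutions and of elements of order 3, with no edge in between.
-- Conversely, two elements whose squares are trivial are always equal or
-- adjacent.  For n ≤ 3 at most two permutations have a nontrivial square, so
-- every cycle passes through an element with trivial square, and no two cycles
-- can lie in different components.
module Submission where

open import Defs
open import Level using (0ℓ)
open import Algebra.Bundles using (Group)
import Algebra.Definitions.RawMonoid as RawMonoidDefs
open import Data.Fin.Base using (Fin; zero; suc; _↑ˡ_)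
open import Data.Fin.Patterns using (0F; 1F; 2F; 3F)
import Data.Fin.Permutation as Perm
open import Data.Fin.Properties using (_≟_; all?; suc-injective; ↑ˡ-injective)
open import Data.Nat.Base
  using (ℕ; zero; suc; _+_; _≤_; _≥_; NonZero; z≤n; s≤s)
open import Data.Nat.Divisibility using (_∣_; _∣?_; ∣-refl; 1∣_)
open import Data.Nat.Properties using (≤-antisym)
open import Data.Product.Base using (∃-syntax; _×_; _,_; proj₁; proj₂)
open import Data.Sum.Base as Sum using (_⊎_; inj₁; inj₂; [_,_]′)
open import Data.Vec.Base using (Vec; []; _∷_; lookup; tabulate)
open import Data.Vec.Properties using (lookup∘tabulate)
open import Function.Base using (_∘_)
open import Function.Bundles using (_⇔_; mk⇔; Injection)
open import Function.Properties.Inverse using (↔⇒↣)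
open import Relation.Binary.Bundles using (Setoid)
open import Relation.Binary.Construct.Closure.ReflexiveTransitive as Star
  using (_◅_; _◅◅_)
import Relation.Binary.Construct.Union as Union
open import Relation.Binary.PropositionalEquality
  using (_≡_; refl; sym; trans; cong; subst; subst₂)
open import Relation.Nullary.Decidable
  using (Dec; _→-dec_; _⊎-dec_; from-yes; from-no)
open import Relation.Nullary.Negation using (¬_; contradiction)
open import Relation.Unary using (Pred; _∈_; _≐_)

-- Walks, components and triangles in a graph.

module _ (Γ : Graph) where
  open Graph Γ
  open Setoid vertices using () renaming (sym to ≈-sym)

  Reachable-sym : ∀ {u v} → Reachable Γ u v → Reachable Γ v u
  Reachable-sym = Star.reverse (Union.symmetric {L = _≈_} {R = _~_} ≈-sym ~-sym)

  -- A walk from `x` to `y` would extend to one from `u` to `v`, and prefixing that walk or its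
  -- reverse identifies the two components.
  distinctComponents⇒unreachable : ∀ {u v x y} →
    ¬ (component Γ u ≐ component Γ v) →
    x ∈ component Γ u → y ∈ component Γ v → ¬ Reachable Γ x y
  distinctComponents⇒unreachable distinct u⟶x v⟶y x⟶y =
    distinct (Reachable-sym u⟶v ◅◅_ , u⟶v ◅◅_)
    where u⟶v = u⟶x ◅◅ x⟶y ◅◅ Reachable-sym v⟶y

  triangle : (c : Fin 3 → V) → (∀ {i j} → c i ≈ c j → i ≡ j) →
             (∀ {i j} → ¬ i ≡ j → c i ~ c j) →
             ContainsCycle Γ (component Γ (c zero))
  triangle c injective adjacent = record
    { c         = c
    ; injective = injective
    ; adjacent  = λ { 0F → adjacent λ () ; 1F → adjacent λ () }
    ; closed    = adjacent λ ()
    } , λ { 0F → Star.ε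
          ; 1F → inj₂ (adjacent λ ()) ◅ Star.ε
          ; 2F → inj₂ (adjacent λ ()) ◅ Star.ε
          }

-- Orders of group elements.

module _ (G : Group 0ℓ 0ℓ) where
  open Group G hiding (_-_) renaming (refl to ≈-refl; sym to ≈-sym; trans to ≈-trans)
  open RawMonoidDefs rawMonoid using () renaming (_×_ to power)

  HasOrder-unique : ∀ {x k l} → HasOrder G x k → HasOrder G x l → k ≡ l
  HasOrder-unique ok ol = ≤-antisym
    (K.minimal _ L.positive L.power≈ε) (L.minimal _ K.positive K.power≈ε)
    where module K = HasOrder ok
          module L = HasOrder ol

  HasOrder-resp : ∀ {k x y} → x ≈ y → HasOrder G x k → HasOrder G y k
  HasOrder-resp {k} x≈y o = record
    { positive = positive
    ; power≈ε  = ≈-trans (power-cong k (≈-sym x≈y)) power≈ε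
    ; minimal  = λ m 0<m e → minimal m 0<m (≈-trans (power-cong m x≈y) e)
    }
    where
    open HasOrder o
    power-cong : ∀ k {x y} → x ≈ y → power k x ≈ power k y
    power-cong zero    x≈y = ≈-refl
    power-cong (suc k) x≈y = ∙-cong x≈y (power-cong k x≈y)

  HasOrder-one : ∀ {x} → x ≈ ε → HasOrder G x 1
  HasOrder-one x≈ε = record
    { positive = s≤s z≤n
    ; power≈ε  = ≈-trans (identityʳ _) x≈ε
    ; minimal  = λ _ 0<m _ → 0<m
    }

  HasOrder-two : ∀ {x} → power 2 x ≈ ε → ¬ x ≈ ε → HasOrder G x 2
  HasOrder-two {x} x²≈ε x≉ε = record
    { positive = s≤s z≤n
    ; power≈ε  = x²≈ε
    ; minimal  = minimal
    }
    where
    minimal : ∀ m → 1 ≤ m → power m x ≈ ε → 2 ≤ m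
    minimal 1             _ x¹≈ε = contradiction (≈-trans (≈-sym (identityʳ x)) x¹≈ε) x≉ε
    minimal (suc (suc _)) _ _    = s≤s (s≤s z≤n)

  HasOrder-three : ∀ {x} → power 3 x ≈ ε → ¬ x ≈ ε → HasOrder G x 3
  HasOrder-three {x} x³≈ε x≉ε = record
    { positive = s≤s z≤n
    ; power≈ε  = x³≈ε
    ; minimal  = minimal
    }
    where
    minimal : ∀ m → 1 ≤ m → power m x ≈ ε → 3 ≤ m
    minimal 1 _ x¹≈ε = contradiction (≈-trans (≈-sym (identityʳ x)) x¹≈ε) x≉ε
    -- A trivial square and a trivial cube give `x = x ∙ x² = x³ = ε`.
    minimal 2 _ x²≈ε = contradiction
      (≈-trans (≈-sym (identityʳ x)) (≈-trans (≈-sym (∙-congˡ x²≈ε)) x³≈ε)) x≉ε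
    minimal (suc (suc (suc _))) _ _ = s≤s (s≤s (s≤s z≤n))

  -- Separation by two incomparable orders.

  module _ {p q : ℕ} (p∤q : ¬ p ∣ q) (q∤p : ¬ q ∣ p) where

    private
      S : Pred Carrier 0ℓ
      S x = ¬ HasOrder G x p × ¬ HasOrder G x q

      Γ : Graph
      Γ = orderSupergraph G - S

      -- Doubly negated because x ∉ S only refutes that x has neither order.
      order-preserved : ∀ {u v} → Reachable Γ u v →
                        ¬ ¬ HasOrder G (proj₁ u) p → ¬ ¬ HasOrder G (proj₁ v) p
      order-preserved Star.ε ou = ou
      order-preserved (inj₁ u≈w ◅ w⟶v) ou =
        order-preserved w⟶v λ ow → ou (ow ∘ HasOrder-resp u≈w)
      order-preserved (_◅_ {j = w , w∉S} (inj₂ (_ , k , l , ok , ol , k∣l⊎l∣k)) w⟶v) ou =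
        -- If `w` lacked order `p`, it would have order `q` because it survives the deletion; the
        -- edge to `u` of order `p` would then make `p` and `q` comparable.
        order-preserved w⟶v λ ow → w∉S (ow , λ ow′ → ou λ ou′ →
          [ p∤q , q∤p ]′
            (subst₂ (λ k l → k ∣ l ⊎ l ∣ k)
              (HasOrder-unique ok ou′) (HasOrder-unique ol ow′) k∣l⊎l∣k))

      sameOrder-triangle : ∀ {k} (c : Fin 3 → Graph.V Γ) →
        (∀ {i j} → proj₁ (c i) ≈ proj₁ (c j) → i ≡ j) →
        (∀ i → HasOrder G (proj₁ (c i)) k) →
        ContainsCycle Γ (component Γ (c zero))
      sameOrder-triangle c injective order = triangle Γ c injective
        λ i≢j → i≢j ∘ injective , _ , _ , order _ , order _ , inj₁ ∣-refl

    -- Three elements of equal order form a triangle, and walks cannot leave the elements of order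
    -- `p`, so the two triangles lie in different components.
    twoOrders⇒cyclicallySeparable : (a b : Fin 3 → Carrier) →
      (∀ {i j} → a i ≈ a j → i ≡ j) → (∀ i → HasOrder G (a i) p) →
      (∀ {i j} → b i ≈ b j → i ≡ j) → (∀ i → HasOrder G (b i) q) →
      CyclicallySeparable (orderSupergraph G)
    twoOrders⇒cyclicallySeparable a b a-injective a-order b-injective b-order = S , record
      { isVertexCutset = record
        { resp-≈       = λ x≈y (x≁p , x≁q) →
            x≁p ∘ HasOrder-resp (≈-sym x≈y) , x≁q ∘ HasOrder-resp (≈-sym x≈y)
        ; disconnected = λ connected → unreachable (connected _ _)
        }
      ; twoCyclicComponents =
          a′ zero , b′ zero
          , (λ same → unreachable (proj₂ same Star.ε))
          , sameOrder-triangle a′ a-injective a-order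
          , sameOrder-triangle b′ b-injective b-order
      }
      where
      a′ b′ : Fin 3 → Graph.V Γ
      a′ i = a i , λ (a≁p , _) → a≁p (a-order i)
      b′ i = b i , λ (_ , b≁q) → b≁q (b-order i)

      unreachable : ¬ Reachable Γ (a′ zero) (b′ zero)
      unreachable a⟶b = order-preserved a⟶b (λ a≁p → a≁p (a-order zero)) λ b~p →
        p∤q (subst (p ∣_) (HasOrder-unique b~p (b-order zero)) ∣-refl)

  -- Elements with trivial square.

  OrderTwoOrTrivial : Carrier → Set
  OrderTwoOrTrivial x = ∃[ k ] HasOrder G x k × (k ≡ 1 ⊎ k ≡ 2)

  -- The order is decided by whether `x ≈ ε`, which may be undecidable in a general group; hence the
  -- double negation.
  square≈ε⇒order : ∀ {x} → power 2 x ≈ ε → ¬ ¬ OrderTwoOrTrivial x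
  square≈ε⇒order x²≈ε none = none
    (2 , HasOrder-two x²≈ε (λ x≈ε → none (1 , HasOrder-one x≈ε , inj₁ refl)) , inj₂ refl)

  square≈ε⇒reachable : ∀ {S} {u v : Graph.V (orderSupergraph G - S)} →
    power 2 (proj₁ u) ≈ ε → power 2 (proj₁ v) ≈ ε →
    ¬ ¬ Reachable (orderSupergraph G - S) u v
  square≈ε⇒reachable u²≈ε v²≈ε unreachable =
    square≈ε⇒order u²≈ε λ (k , ok , k≡1⊎2) →
    square≈ε⇒order v²≈ε λ (l , ol , l≡1⊎2) →
    -- The edge requires distinct endpoints; equal ones would already be joined by a step along
    -- `_≈_`.
    unreachable (inj₂ ( (λ u≈v → unreachable (inj₁ u≈v ◅ Star.ε))
                      , k , l , ok , ol , comparable k≡1⊎2 l≡1⊎2) ◅ Star.ε)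
    where
    comparable : ∀ {k l} → k ≡ 1 ⊎ k ≡ 2 → l ≡ 1 ⊎ l ≡ 2 → k ∣ l ⊎ l ∣ k
    comparable (inj₁ refl) _           = inj₁ (1∣ _)
    comparable _           (inj₁ refl) = inj₂ (1∣ _)
    comparable (inj₂ refl) (inj₂ refl) = inj₁ ∣-refl

  atMostTwoNoninvolutions⇒¬cyclicallySeparable : ∀ {a b} →
    (∀ x → power 2 x ≈ ε ⊎ x ≈ a ⊎ x ≈ b) →
    ¬ CyclicallySeparable (orderSupergraph G)
  atMostTwoNoninvolutions⇒¬cyclicallySeparable {a} {b} classify
    (S , record { twoCyclicComponents = u , v , distinct , (γ , γ⊆u) , (δ , δ⊆v) })
    with involutionOn γ | involutionOn δ
    where
    involutionOn : (γ : Cycle (orderSupergraph G - S)) →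
                   ∃[ i ] power 2 (proj₁ (Cycle.c γ i)) ≈ ε
    involutionOn γ = pick (classify _) (classify _) (classify _)
      where
      open Cycle γ
      same : ∀ {i j z} → proj₁ (c i) ≈ z → proj₁ (c j) ≈ z → i ≡ j
      same ci≈z cj≈z = injective (≈-trans ci≈z (≈-sym cj≈z))

      Classified : Fin _ → Set
      Classified i = let x = proj₁ (c i) in power 2 x ≈ ε ⊎ x ≈ a ⊎ x ≈ b

      pick : Classified 0F → Classified 1F → Classified 2F →
             ∃[ i ] power 2 (proj₁ (c i)) ≈ ε
      pick (inj₁ e) _ _ = 0F , e
      pick _ (inj₁ e) _ = 1F , e
      pick _ _ (inj₁ e) = 2F , e
      -- Pigeonhole: three distinct vertices cannot all lie among `a` and `b`.
      pick (inj₂ (inj₁ p)) (inj₂ (inj₁ q)) _ = contradiction (same p q) λ ()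
      pick (inj₂ (inj₂ p)) (inj₂ (inj₂ q)) _ = contradiction (same p q) λ ()
      pick (inj₂ (inj₁ p)) _ (inj₂ (inj₁ q)) = contradiction (same p q) λ ()
      pick (inj₂ (inj₂ p)) _ (inj₂ (inj₂ q)) = contradiction (same p q) λ ()
      pick _ (inj₂ (inj₁ p)) (inj₂ (inj₁ q)) = contradiction (same p q) λ ()
      pick _ (inj₂ (inj₂ p)) (inj₂ (inj₂ q)) = contradiction (same p q) λ ()
  ... | i , γi²≈ε | j , δj²≈ε =
    square≈ε⇒reachable γi²≈ε δj²≈ε
      (distinctComponents⇒unreachable (orderSupergraph G - S) distinct (γ⊆u i) (δ⊆v j))

-- Small symmetric groups by exhaustive check.

module _ {n : ℕ} (ρ : Perm.Permutation′ n) where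

  private
    Classified : (Fin n → Fin n) → Set
    Classified f = (∀ i → f (f i) ≡ i)
                 ⊎ (∀ i → f i ≡ ρ Perm.⟨$⟩ʳ i)
                 ⊎ (∀ i → f i ≡ ρ Perm.⟨$⟩ˡ i)

  -- A vector lists the values of a self-map of `Fin n`, so all maps can be enumerated entry by
  -- entry; injectivity singles out the permutations.
  Classification : Vec (Fin n) n → Set
  Classification v = (∀ i j → lookup v i ≡ lookup v j → i ≡ j) → Classified (lookup v)

  classification? : ∀ v → Dec (Classification v)
  classification? v =
    (all? λ i → all? λ j → (lookup v i ≟ lookup v j) →-dec (i ≟ j))
    →-dec
    ((all? λ i → lookup v (lookup v i) ≟ i)
     ⊎-dec (all? λ i → lookup v i ≟ (ρ Perm.⟨$⟩ʳ i))
     ⊎-dec (all? λ i → lookup v i ≟ (ρ Perm.⟨$⟩ˡ i)))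

  classification⇒¬cyclicallySeparable : (∀ v → Classification v) →
    ¬ CyclicallySeparable (orderSupergraph (symmetricGroup n))
  classification⇒¬cyclicallySeparable classify =
    atMostTwoNoninvolutions⇒¬cyclicallySeparable (symmetricGroup n) {ρ} {Perm.flip ρ}
      λ π → let f = π Perm.⟨$⟩ʳ_
                v≗f = lookup∘tabulate f
            in Sum.map
      -- `power 2 π` sends `i` to `f (f i)` by computation, so only the two lookups need rewriting.
      (λ e i → trans (sym (trans (v≗f _) (cong f (v≗f i)))) (e i))
      (Sum.map (λ e i → trans (sym (v≗f i)) (e i)) (λ e i → trans (sym (v≗f i)) (e i)))
      (classify (tabulate f) λ i j e →
        Injection.injective (↔⇒↣ π) (trans (sym (v≗f i)) (trans e (v≗f j))))

-- The left transposition acts first, so for distinct `i` and `j` this is the cycle from 0 to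
-- `suc i` to `suc j` and back to 0.
threeCycle : ∀ {n} → Fin n → Fin n → Perm.Permutation′ (suc n)
threeCycle i j = Perm.transpose zero (suc i) Perm.∘ₚ Perm.transpose zero (suc j)

-- On one or two points every permutation has trivial square, so the identity can fill the place of
-- the exceptional `ρ`.
¬cyclicallySeparable₁ : ¬ CyclicallySeparable (orderSupergraph (symmetricGroup 1))
¬cyclicallySeparable₁ = classification⇒¬cyclicallySeparable Perm.id λ where
  (a ∷ []) → from-yes (all? λ a → classification? Perm.id (a ∷ [])) a

¬cyclicallySeparable₂ : ¬ CyclicallySeparable (orderSupergraph (symmetricGroup 2))
¬cyclicallySeparable₂ = classification⇒¬cyclicallySeparable Perm.id λ where
  (a ∷ b ∷ []) → from-yes (all? λ a → all? λ b → classification? Perm.id (a ∷ b ∷ [])) a b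

¬cyclicallySeparable₃ : ¬ CyclicallySeparable (orderSupergraph (symmetricGroup 3))
¬cyclicallySeparable₃ =
  -- The permutations of three points with nontrivial square are this 3-cycle and its inverse.
  let ρ = threeCycle 0F 1F in classification⇒¬cyclicallySeparable ρ λ where
  (a ∷ b ∷ c ∷ []) →
    from-yes (all? λ a → all? λ b → all? λ c → classification? ρ (a ∷ b ∷ c ∷ [])) a b c

-- Transpositions and 3-cycles on at least four points.

module _ {m : ℕ} where

  private
    n : ℕ
    n = 4 + m

    moved : Fin 3 → Fin n
    moved i = suc (i ↑ˡ m)

    next : Fin 3 → Fin 3
    next 0F = 1F
    next 1F = 2F
    next 2F = 0F

    -- These are (0 1), (0 2), (0 3) and (0 1 2), (0 2 3), (0 3 1); within each family the image of
    -- 0 tells the members apart.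
    involution rotation : Fin 3 → Perm.Permutation′ n
    involution i = Perm.transpose 0F (moved i)
    rotation i = threeCycle (i ↑ˡ m) (next i ↑ˡ m)

    -- All the permutations used fix every point beyond the first four, so their identities hold by
    -- computation in each of these five cases.
    byPoints : {P : Fin n → Set} → P 0F → P 1F → P 2F → P 3F →
               (∀ i → P (suc (suc (suc (suc i))))) → ∀ i → P i
    byPoints p₀ p₁ p₂ p₃ p = λ where
      0F → p₀
      1F → p₁
      2F → p₂
      3F → p₃
      (suc (suc (suc (suc i)))) → p i

    moved-injective : ∀ {i j} → moved i ≡ moved j → i ≡ j
    moved-injective = ↑ˡ-injective _ _ _ ∘ suc-injective

    involution-injective : ∀ {i j} → involution i Perm.≈ involution j → i ≡ j
    involution-injective e = moved-injective (e 0F)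

    -- The second transposition compares `moved i` with the point it moves, which computes only once
    -- `i` is concrete.
    rotation-zero : ∀ i → rotation i Perm.⟨$⟩ʳ 0F ≡ moved i
    rotation-zero = λ { 0F → refl ; 1F → refl ; 2F → refl }

    rotation-injective : ∀ {i j} → rotation i Perm.≈ rotation j → i ≡ j
    rotation-injective {i} {j} e =
      moved-injective (trans (sym (rotation-zero i)) (trans (e 0F) (rotation-zero j)))

    involution-order : ∀ i → HasOrder (symmetricGroup n) (involution i) 2
    involution-order i = HasOrder-two (symmetricGroup n) (square i)
      λ e → contradiction (e 0F) λ ()
      where
      square : ∀ i → (involution i Perm.∘ₚ involution i) Perm.≈ Perm.id
      square 0F = byPoints refl refl refl refl λ _ → refl
      square 1F = byPoints refl refl refl refl λ _ → refl
      square 2F = byPoints refl refl refl refl λ _ → refl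

    rotation-order : ∀ i → HasOrder (symmetricGroup n) (rotation i) 3
    rotation-order i = HasOrder-three (symmetricGroup n) (cube i)
      λ e → contradiction (trans (sym (rotation-zero i)) (e 0F)) λ ()
      where
      cube : ∀ i → (rotation i Perm.∘ₚ rotation i Perm.∘ₚ rotation i) Perm.≈ Perm.id
      cube 0F = byPoints refl refl refl refl λ _ → refl
      cube 1F = byPoints refl refl refl refl λ _ → refl
      cube 2F = byPoints refl refl refl refl λ _ → refl

  cyclicallySeparable₄₊ : CyclicallySeparable (orderSupergraph (symmetricGroup (4 + m)))
  cyclicallySeparable₄₊ = twoOrders⇒cyclicallySeparable (symmetricGroup n)
    (from-no (2 ∣? 3)) (from-no (3 ∣? 2))
    involution rotation
    involution-injective involution-order rotation-injective rotation-order

mainTheorem6 : (n : ℕ) .{{_ : NonZero n}} →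
    CyclicallySeparable (orderSupergraph (symmetricGroup n)) ⇔ n ≥ 4
mainTheorem6 1 = mk⇔ (λ s → contradiction s ¬cyclicallySeparable₁) λ { (s≤s ()) }
mainTheorem6 2 = mk⇔ (λ s → contradiction s ¬cyclicallySeparable₂) λ { (s≤s (s≤s ())) }
mainTheorem6 3 = mk⇔ (λ s → contradiction s ¬cyclicallySeparable₃) λ { (s≤s (s≤s (s≤s ()))) }
mainTheorem6 (suc (suc (suc (suc m)))) =
  mk⇔ (λ _ → s≤s (s≤s (s≤s (s≤s z≤n)))) λ _ → cyclicallySeparable₄₊
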